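{- Let $\mathcal{M}=\{M_i\}_{i\in\mathcal{I}}$ be a family of MDPs with $M_i=(S,s_0,Act,P_i)$, let $T\subseteq S$ be a set of target states, let $\lambda\in[0,1]$, and let $\mathcal{G}_{\mathcal{M}}$ be the game abstraction of $\mathcal{M}$. Assume that $\mathbb{P}_{\max}[\mathcal{G}_{\mathcal{M}}\models\Diamond T]$ is achieved by the Player 1 policy $\sigma_1$. Then $$\mathbb{P}_{\max}[\mathcal{G}_{\mathcal{M}}\models\Diamond T]\geq\lambda\quad\text{implies}\quad \forall i\in\mathcal{I}:\ \mathbb{P}[M_i^{\sigma_1}\models\Diamond T]\geq\lambda .$$
   Context: An MDP is a tuple $M=(S,s_0,Act,P)$ with a countable set $S$ of states, an initial state $s_0\in S$, a finite set $Act$ of actions, and a partial transition function $P: S\times Act\nrightarrow Distr(S)$, where $Distr(S)$ is the set of probability distributions on $S$. Write $Act(s)=\{\alpha\in Act: P(s,\alpha)\neq\bot\}$ (where $\bot$ means undefined); it is assumed that $Act(s)\neq\emptyset$ for all $s$. A policy is deterministic and memoryless: a function $\sigma:S\to Act$ with $\sigma(s)\in Act(s)$ for all $s$. It induces the Markov chain $M^\sigma=(S,s_0,P^\sigma)$ with $P^\sigma(s)=P(s,\sigma(s))$. $\mathbb{P}[M^\sigma\models\Diamond T]$ is the probability of reaching $T$ in $M^\sigma$ from $s_0$. A family of MDPs over state set $S$ and action set $Act$ is an indexed set $\mathcal{M}=\{M_i=(S,s_0,Act,P_i)\}_{i\in\mathcal{I}}$ with $\mathcal{I}$ a finite set of identifiers,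 such that for all $s,\alpha$ and $i,j\in\mathcal{I}$, $P_i(s,\alpha)\neq\bot$ implies $P_j(s,\alpha)\neq\bot$. Hence all members have the same available action sets $Act(s)$ and the same policies. A stochastic game is $G=(M,S_1,S_2)$ where $M$ is an MDP (the underlying MDP) and $(S_1,S_2)$ partitions its state set into Player 1 and Player 2 states. A Player $k$ policy $\sigma_k$ ($k=1,2$) is a deterministic memoryless map assigning to each state of $S_k$ an available action; $\Sigma_k$ is the set of these. A pair $(\sigma_1,\sigma_2)$ is a policy of the underlying MDP and induces a Markov chain $G^{\sigma_1,\sigma_2}$. Player 1 maximises and Player 2 minimises the reachability probability: $$\mathbb{P}_{\max}[G\models\Diamond T]=\sup_{\sigma_1\in\Sigma_1}\inf_{\sigma_2\in\Sigma_2}\mathbb{P}[G^{\sigma_1,\sigma_2}\models\Diamond T].$$ That this value is achieved by $\sigma_1$ means that $\sigma_1$ is an optimal Player 1 policy, i.e. $\inf_{\sigma_2\in\Sigma_2}\mathbb{P}[G^{\sigma_1,\sigma_2}\models\Diamond T]=\mathbb{P}_{\max}[G\models\Diamond T]$. For each $(s,\alpha)$ let $\sim_{s,\alpha}$ be the equivalence relation on $\mathcal{I}$ with $i\sim_{s,\alpha}j$ iff $P_i(s,\alpha)=P_j(s,\alpha)$, and let $\mathcal{I}/\!\sim_{s,\alpha}$ be the corresponding partition of $\mathcal{I}$. The game abstraction of $\mathcal{M}$ is the stochastic game $\mathcal{G}_{\mathcal{M}}=(M,S_1,S_2)$ with $S_1=S$, $S_2=S\times Act$ and underlying MDP $M=(S_1\cup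 S_2,s_0,Act\cup 2^{\mathcal{I}},P_{\mathcal{G}})$, where: for $s\in S_1$, the available actions are $Act(s)$ and $P_{\mathcal{G}}(s,\alpha)$ moves to $(s,\alpha)$ with probability 1 for each $\alpha\in Act(s)$; for $(s,\alpha)\in S_2$, the available actions are the classes $I\in\mathcal{I}/\!\sim_{s,\alpha}$, and $P_{\mathcal{G}}((s,\alpha),I)=P_i(s,\alpha)$ for any $i\in I$. (Only pairs with $\alpha\in Act(s)$ matter; other pairs $(s,\alpha)$ have no incoming transitions and may be dropped from $S_2$.) A Player 1 policy $\sigma_1$ of $\mathcal{G}_{\mathcal{M}}$ maps each $s\in S$ to an action in $Act(s)$, hence is also a policy of every $M_i$. -}

module Defs where

open import Level using (0ℓ)
open import Algebra.Bundles using (CommutativeRing)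
import Algebra.Properties.Ring as RingProperties
open import Axiom.ExcludedMiddle using (ExcludedMiddle)
open import Data.Bool using (Bool; if_then_else_)
open import Data.Empty using (⊥; ⊥-elim)
open import Data.Fin using (Fin; zero; suc; toℕ)
open import Data.Fin.Properties using (toℕ<n; toℕ-injective; suc-injective; *↔×; +↔⊎; 2↔Bool)
open import Data.Fin.Subset using (Subset; _∈_)
open import Data.List using (List; []; _∷_; map; foldr)
open import Data.List.Relation.Unary.All as All using (All; []; _∷_)
open import Data.List.Relation.Unary.AllPairs using ([]; _∷_)
open import Data.List.Relation.Unary.Unique.Propositional using (Unique)
import Data.List.Relation.Unary.Unique.Propositional.Properties as Unique
open import Data.Maybe as Maybe using (Maybe; just; nothing; Is-just; to-witness)
open import Data.Maybe.Relation.Unary.Any as MaybeAny using (just)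
open import Data.Maybe.Relation.Binary.Pointwise using (Pointwise)
open import Data.Nat as ℕ using (ℕ; zero; suc)
import Data.Nat.Properties as ℕ
import Data.Nat.DivMod as ℕ
open import Data.Product using (∃; _×_; _,_; proj₁; proj₂)
open import Data.Sum using (_⊎_; inj₁; inj₂; [_,_])
open import Data.Sum.Function.Propositional using (_⊎-↔_)
open import Data.Sum.Properties using (inj₁-injective)
open import Data.Product.Function.NonDependent.Propositional using (_×-↔_)
open import Data.Unit using (tt)
open import Data.Vec using ([]; _∷_; head; tail; tabulate)
import Data.Vec.Properties as Vec
open import Function using (const; _∘_; _↣_; _↔_; _⇔_; mk↔ₛ′; mk↣; mk⇔)
open import Function.Bundles using (Injection)
open import Function.Construct.Composition using (_↔-∘_)
open import Function.Construct.Symmetry using (↔-sym)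
open import Function.Properties.Inverse using (↔⇒↣)
open import Relation.Binary.PropositionalEquality using (_≡_; _≢_; refl; sym; trans; cong)
open import Relation.Binary.Structures using (IsTotalOrder)
open import Relation.Nullary using (¬_; Dec; does; yes; no)
open import Relation.Nullary.Decidable using (dec-true)
open import Relation.Unary using (Pred; U)

-- The axioms characterising the real numbers up to isomorphism.
record CompleteOrderedField : Set₁ where
  field
    commutativeRing : CommutativeRing 0ℓ 0ℓ

  open CommutativeRing commutativeRing public
    using (Carrier; _≈_; _+_; _*_; -_; 0#; 1#)

  infix 4 _≤_
  field
    _≤_          : Carrier → Carrier → Set
    isTotalOrder : IsTotalOrder _≈_ _≤_
    +-monoˡ-≤    : ∀ z {x y} → x ≤ y → x + z ≤ y + z
    *-nonneg     : ∀ {x y} → 0# ≤ x → 0# ≤ y → 0# ≤ x * y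
    0≉1          : ¬ 0# ≈ 1#
    inverse      : ∀ {x} → ¬ x ≈ 0# → ∃ λ y → x * y ≈ 1#

  UpperBound : Pred Carrier 0ℓ → Carrier → Set
  UpperBound X u = ∀ {x} → X x → x ≤ u

  IsLUB : Pred Carrier 0ℓ → Carrier → Set
  IsLUB X u = UpperBound X u × (∀ {v} → UpperBound X v → u ≤ v)

  field
    complete : ∀ X → ∃ X → ∃ (UpperBound X) → ∃ (IsLUB X)

Finite : Set → Set
Finite A = ∃ λ n → A ↔ Fin n

-- Finite or countably infinite.
Countable : Set → Set
Countable A = A ↣ ℕ

⊎-finite : ∀ {A B} → Finite A → Finite B → Finite (A ⊎ B)
⊎-finite (m , f) (n , g) = m ℕ.+ n , (↔-sym +↔⊎ ↔-∘ (f ⊎-↔ g))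

subset-finite : ∀ n → Finite (Subset n)
subset-finite zero    = 1 , mk↔ₛ′ (λ _ → zero) (λ _ → []) (λ { zero → refl }) (λ { [] → refl })
subset-finite (suc n) with subset-finite n
... | k , f = 2 ℕ.* k , (↔-sym *↔× ↔-∘ ((↔-sym 2↔Bool ×-↔ f) ↔-∘ uncons))
  where
  uncons = mk↔ₛ′ (λ X → head X , tail X) (λ (b , X) → b ∷ X) (λ _ → refl) (λ { (_ ∷ _) → refl })

×Fin-countable : ∀ {A} n → Countable A → Countable (A × Fin (suc n))
×Fin-countable {A} n c = mk↣ {to = code} code-injective
  where
  code : A × Fin (suc n) → ℕ
  code (a , j) = toℕ j ℕ.+ Injection.to c a ℕ.* suc n

  code-% : ∀ p → code p ℕ.% suc n ≡ toℕ (proj₂ p)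
  code-% (a , j) = trans (ℕ.[m+kn]%n≡m%n (toℕ j) (Injection.to c a) (suc n)) (ℕ.m<n⇒m%n≡m (toℕ<n j))

  code-injective : ∀ {p q} → code p ≡ code q → p ≡ q
  code-injective {a , j} {b , k} e
    with refl ← toℕ-injective (trans (sym (code-% (a , j))) (trans (cong (ℕ._% suc n) e) (code-% (b , k))))
    = cong (_, j) (Injection.injective c
        (ℕ.*-cancelʳ-≡ _ _ (suc n) (ℕ.+-cancelˡ-≡ (toℕ j) _ _ e)))

countable-via : ∀ {A B : Set} (f : A → B) → (∀ {x y} → f x ≡ f y → x ≡ y) → Countable B → Countable A
countable-via f f-inj c = mk↣ {to = Injection.to c ∘ f} (f-inj ∘ Injection.injective c)

data Player : Set where
  player₁ player₂ : Player

-- Probability is developed classically, over an arbitrary model of the reals.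
module Theory (em : ExcludedMiddle 0ℓ) (ℝ : CompleteOrderedField) where

  open CompleteOrderedField ℝ
  private
    module R = CommutativeRing commutativeRing
    module O = IsTotalOrder isTotalOrder
    open RingProperties R.ring using (-‿distribˡ-*; -‿involutive)

  -- As usual, sup X is the least upper bound when X is inhabited and bounded
  -- above, and 0 otherwise.  All suprema and infima taken below are of
  -- inhabited subsets of the unit interval.
  sup : Pred Carrier 0ℓ → Carrier
  sup X with em {∃ X × ∃ (UpperBound X)}
  ... | yes (inhabited , bounded) = proj₁ (complete X inhabited bounded)
  ... | no _                      = 0#

  inf : Pred Carrier 0ℓ → Carrier
  inf X = - sup (λ x → X (- x))

  Range : {A : Set} → (A → Carrier) → Pred Carrier 0ℓ
  Range f x = ∃ λ a → x ≈ f a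

  ⨆ ⨅ : {A : Set} → (A → Carrier) → Carrier
  ⨆ f = sup (Range f)
  ⨅ f = inf (Range f)

  sum : {A : Set} → (A → Carrier) → List A → Carrier
  sum f xs = foldr _+_ 0# (map f xs)

  -- For f ≥ 0, the sum of f over Q is the supremum of its finite partial sums.
  PartialSum : {A : Set} → Pred A 0ℓ → (A → Carrier) → Pred Carrier 0ℓ
  PartialSum Q f x = ∃ λ xs → Unique xs × All Q xs × x ≈ sum f xs

  record Distr (A : Set) : Set where
    field
      mass    : A → Carrier
      nonneg  : ∀ a → 0# ≤ mass a
      total-1 : IsLUB (PartialSum U mass) 1#

  open Distr public

  infix 4 _≈ᴰ_
  _≈ᴰ_ : {A : Set} → Distr A → Distr A → Set
  d ≈ᴰ e = ∀ a → mass d a ≈ mass e a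

  0≤1 : 0# ≤ 1#
  0≤1 with O.total 0# 1#
  ... | inj₁ 0≤1 = 0≤1
  ... | inj₂ 1≤0 = O.≤-respʳ-≈ -1*-1≈1 (*-nonneg 0≤-1 0≤-1)
    where
    -1*-1≈1 : - 1# * - 1# ≈ 1#
    -1*-1≈1 = R.trans (R.sym (-‿distribˡ-* 1# (- 1#)))
                (R.trans (R.-‿cong (R.*-identityˡ (- 1#))) (-‿involutive 1#))

    0≤-1 : 0# ≤ - 1#
    0≤-1 = O.≤-respˡ-≈ (R.-‿inverseʳ 1#) (O.≤-respʳ-≈ (R.+-identityˡ (- 1#)) (+-monoˡ-≤ (- 1#) 1≤0))

  module _ {A : Set} (a : A) where

    diracMass : A → Carrier
    diracMass x = if does (em {a ≡ x}) then 1# else 0#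

    private
      nonneg′ : ∀ x → 0# ≤ diracMass x
      nonneg′ x with em {a ≡ x}
      ... | yes _ = 0≤1
      ... | no  _ = O.refl

      sum≈0 : ∀ {xs} → All (a ≢_) xs → sum diracMass xs ≈ 0#
      sum≈0 [] = R.refl
      sum≈0 (_∷_ {x} a≢x a∉xs) with em {a ≡ x}
      ... | yes a≡x = ⊥-elim (a≢x a≡x)
      ... | no  _   = R.trans (R.+-identityˡ _) (sum≈0 a∉xs)

      sum≤1 : ∀ {xs} → Unique xs → sum diracMass xs ≤ 1#
      sum≤1 [] = 0≤1
      sum≤1 (_∷_ {x} x∉xs xs!) with em {a ≡ x}
      ... | yes refl = O.reflexive (R.trans (R.+-congˡ (sum≈0 x∉xs)) (R.+-identityʳ 1#))
      ... | no  _    = O.≤-respˡ-≈ (R.sym (R.+-identityˡ _)) (sum≤1 xs!)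

      sum[a]≈1 : sum diracMass (a ∷ []) ≈ 1#
      sum[a]≈1 with em {a ≡ a}
      ... | yes _  = R.+-identityʳ 1#
      ... | no a≢a = ⊥-elim (a≢a refl)

    dirac : Distr A
    dirac .mass   = diracMass
    dirac .nonneg = nonneg′
    dirac .total-1 =
      (λ (_ , xs! , _ , x≈) → O.≤-respˡ-≈ (R.sym x≈) (sum≤1 xs!)) ,
      (λ ub → ub (a ∷ [] , [] ∷ [] , _ ∷ [] , R.sym sum[a]≈1))

  module _ {A : Set} (B : Set) (d : Distr A) where

    embedMass : A ⊎ B → Carrier
    embedMass = [ mass d , const 0# ]

    private
      lefts : List (A ⊎ B) → List A
      lefts []            = []
      lefts (inj₁ a ∷ xs) = a ∷ lefts xs
      lefts (inj₂ _ ∷ xs) = lefts xs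

      sum-lefts : ∀ xs → sum embedMass xs ≈ sum (mass d) (lefts xs)
      sum-lefts []            = R.refl
      sum-lefts (inj₁ a ∷ xs) = R.+-congˡ (sum-lefts xs)
      sum-lefts (inj₂ _ ∷ xs) = R.trans (R.+-identityˡ _) (sum-lefts xs)

      lefts-∉ : ∀ {a xs} → All (inj₁ a ≢_) xs → All (a ≢_) (lefts xs)
      lefts-∉ {xs = []}          []        = []
      lefts-∉ {xs = inj₁ _ ∷ _} (p ∷ ps)  = (p ∘ cong inj₁) ∷ lefts-∉ ps
      lefts-∉ {xs = inj₂ _ ∷ _} (_ ∷ ps)  = lefts-∉ ps

      lefts-! : ∀ {xs} → Unique xs → Unique (lefts xs)
      lefts-! {[]}         []       = []
      lefts-! {inj₁ _ ∷ _} (p ∷ ps) = lefts-∉ p ∷ lefts-! ps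
      lefts-! {inj₂ _ ∷ _} (_ ∷ ps) = lefts-! ps

      sum-map : ∀ xs → sum embedMass (map inj₁ xs) ≡ sum (mass d) xs
      sum-map []       = refl
      sum-map (x ∷ xs) = cong (mass d x +_) (sum-map xs)

    -- d regarded as a distribution on the disjoint union with B.
    embed : Distr (A ⊎ B)
    embed .mass = embedMass
    embed .nonneg (inj₁ a) = nonneg d a
    embed .nonneg (inj₂ _) = O.refl
    embed .total-1 =
      (λ (xs , xs! , _ , x≈) →
        proj₁ (total-1 d) (lefts xs , lefts-! xs! , All.universal _ _ , R.trans x≈ (sum-lefts xs))) ,
      (λ ub → proj₂ (total-1 d) λ (xs , xs! , _ , x≈) →
        ub (map inj₁ xs , Unique.map⁺ inj₁-injective xs! , All.universal _ _ ,
            R.trans x≈ (R.reflexive (sym (sum-map xs)))))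

  record MarkovChain : Set₁ where
    field
      S  : Set
      s₀ : S
      P  : S → Distr S

  module _ (C : MarkovChain) (T : Pred (MarkovChain.S C) 0ℓ) where
    open MarkovChain C

    -- FirstHit s π: the finite path s ∷ π lies in (S ∖ T)* T.
    data FirstHit : S → List S → Set where
      stop : ∀ {s} → T s → FirstHit s []
      step : ∀ {s t π} → ¬ T s → FirstHit t π → FirstHit s (t ∷ π)

    cylinder : S → List S → Carrier
    cylinder s []      = 1#
    cylinder s (t ∷ π) = mass (P s) t * cylinder t π

    -- ◇ T is the countable disjoint union of the cylinder sets of the finite
    -- paths that reach T at their last state for the first time.
    ℙ[_⊨◇_] : Carrier
    ℙ[_⊨◇_] = sup (PartialSum (FirstHit s₀) (cylinder s₀))

  -- P s α ≡ nothing means that P is undefined at (s , α).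
  record MDP : Set₁ where
    field
      S           : Set
      S-countable : Countable S
      s₀          : S
      Act         : Set
      Act-finite  : Finite Act
      P           : S → Act → Maybe (Distr S)

    Available : S → Act → Set
    Available s α = Is-just (P s α)

    field
      Act-nonempty : ∀ s → ∃ (Available s)

    Policy : Set
    Policy = ∀ s → ∃ (Available s)

    induced : Policy → MarkovChain
    induced σ = record { S = S ; s₀ = s₀ ; P = λ s → to-witness (proj₂ (σ s)) }

  -- A nonempty family, with identifiers Fin (suc m).
  record Family : Set₁ where
    field
      S           : Set
      S-countable : Countable S
      s₀          : S
      Act         : Set
      Act-finite  : Finite Act
      m           : ℕ

    I : Set
    I = Fin (suc m)

    field
      P            : I → S → Act → Maybe (Distr S)
      Act-nonempty : ∀ i s → ∃ λ α → Is-just (P i s α)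
      same-Act     : ∀ i j s α → Is-just (P i s α) → Is-just (P j s α)

    member : I → MDP
    member i = record
      { S = S ; S-countable = S-countable ; s₀ = s₀
      ; Act = Act ; Act-finite = Act-finite
      ; P = P i ; Act-nonempty = Act-nonempty i }

    -- By same-Act the choice of member is immaterial.
    Available : S → Act → Set
    Available = MDP.Available (member zero)

    _∼[_,_]_ : I → S → Act → I → Set
    i ∼[ s , α ] j = Pointwise _≈ᴰ_ (P i s α) (P j s α)

    -- X is the class of i.
    IsClassOf : S → Act → Subset (suc m) → I → Set
    IsClassOf s α X i = ∀ j → j ∈ X ⇔ i ∼[ s , α ] j

  record Game : Set₁ where
    field
      mdp   : MDP
      owner : MDP.S mdp → Player

    open MDP mdp

    PlayerPolicy : Player → Set
    PlayerPolicy k = ∀ s → owner s ≡ k → ∃ (Available s)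

    combine : PlayerPolicy player₁ → PlayerPolicy player₂ → Policy
    combine σ₁ σ₂ s with owner s in eq
    ... | player₁ = σ₁ s eq
    ... | player₂ = σ₂ s eq

    module _ (T : Pred S 0ℓ) where

      -- The value Player 1 secures with σ₁.
      ℙinf : PlayerPolicy player₁ → Carrier
      ℙinf σ₁ = ⨅ λ (σ₂ : PlayerPolicy player₂) → ℙ[ induced (combine σ₁ σ₂) ⊨◇ T ]

      ℙmax : Carrier
      ℙmax = ⨆ ℙinf

      AchievedBy : PlayerPolicy player₁ → Set
      AchievedBy σ₁ = ℙinf σ₁ ≈ ℙmax

  module GameAbstraction (ℳ : Family) where
    open Family ℳ

    S₂ : Set
    S₂ = ∃ λ s → ∃ λ α → Available s α

    Sᴳ Actᴳ : Set
    Sᴳ   = S ⊎ S₂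
    Actᴳ = Act ⊎ Subset (suc m)

    move : ∀ s α → Dec (Available s α) → Maybe (Distr Sᴳ)
    move s α (yes av) = just (dirac (inj₂ (s , α , av)))
    move s α (no _)   = nothing

    available : ∀ {s α} (d : Dec (Available s α)) → Is-just (move s α d) → Available s α
    available (yes av) _ = av

    -- i is an arbitrary element of X: all of them have ≈ᴰ-equal distributions.
    resolve : ∀ s α {X} → Dec (∃ (IsClassOf s α X)) → Maybe (Distr Sᴳ)
    resolve s α (yes (i , _)) = Maybe.map (embed S₂) (P i s α)
    resolve s α (no _)        = nothing

    Pᴳ : Sᴳ → Actᴳ → Maybe (Distr Sᴳ)
    Pᴳ (inj₁ s)           (inj₁ α) = move s α em
    Pᴳ (inj₁ _)           (inj₂ _) = nothing
    Pᴳ (inj₂ _)           (inj₁ _) = nothing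
    Pᴳ (inj₂ (s , α , _)) (inj₂ X) = resolve s α {X} em

    private
      Sᴳ-countable : Countable Sᴳ
      Sᴳ-countable = countable-via tag tag-injective (×Fin-countable (proj₁ Act-finite) S-countable)
        where
        module F = Injection (↔⇒↣ (proj₂ Act-finite))

        tag : Sᴳ → S × Fin (suc (proj₁ Act-finite))
        tag (inj₁ s)           = s , zero
        tag (inj₂ (s , α , _)) = s , suc (F.to α)

        tag-injective : ∀ {x y} → tag x ≡ tag y → x ≡ y
        tag-injective {inj₁ s} {inj₁ t} e = cong (inj₁ ∘ proj₁) e
        tag-injective {inj₁ s} {inj₂ y} e with () ← cong proj₂ e
        tag-injective {inj₂ x} {inj₁ t} e with () ← cong proj₂ e
        tag-injective {inj₂ (s , α , p)} {inj₂ (t , β , q)} e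
          with refl ← cong proj₁ e | refl ← F.injective (suc-injective (cong proj₂ e))
          = cong (λ r → inj₂ (s , α , r)) (MaybeAny.irrelevant (λ _ _ → refl) p q)

      class : ∀ s α i → ∃ λ X → IsClassOf s α X i
      class s α i = tabulate inClass , λ j → mk⇔ (to j) (from j)
        where
        inClass : I → Bool
        inClass j = does (em {i ∼[ s , α ] j})

        to : ∀ j → j ∈ tabulate inClass → i ∼[ s , α ] j
        to j j∈X with em {i ∼[ s , α ] j} | trans (sym (Vec.lookup∘tabulate inClass j)) (Vec.[]=⇒lookup j∈X)
        ... | yes i∼j | _ = i∼j
        ... | no _    | ()

        from : ∀ j → i ∼[ s , α ] j → j ∈ tabulate inClass
        from j i∼j = Vec.lookup⇒[]= j _ (trans (Vec.lookup∘tabulate inClass j) (dec-true em i∼j))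

      map-just : ∀ {A B : Set} {f : A → B} {x : Maybe A} → Is-just x → Is-just (Maybe.map f x)
      map-just (just _) = just tt

      move-defined : ∀ s α (d : Dec (Available s α)) → Available s α → Is-just (move s α d)
      move-defined s α (yes _)  _  = just tt
      move-defined s α (no ¬av) av = ⊥-elim (¬av av)

      resolve-defined : ∀ s α {X} (d : Dec (∃ (IsClassOf s α X))) →
                        Available s α → ∃ (IsClassOf s α X) → Is-just (resolve s α {X} d)
      resolve-defined s α (yes (i , _)) av _ = map-just (same-Act zero i s α av)
      resolve-defined s α (no ¬cl)      _ cl = ⊥-elim (¬cl cl)

      Actᴳ-nonempty : ∀ x → ∃ λ a → Is-just (Pᴳ x a)
      Actᴳ-nonempty (inj₁ s) =
        let α , av = Act-nonempty zero s in inj₁ α , move-defined s α em av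
      Actᴳ-nonempty (inj₂ (s , α , av)) =
        let X , cl = class s α zero in inj₂ X , resolve-defined s α {X} em av (zero , cl)

    𝒢 : Game
    𝒢 = record
      { mdp = record
        { S = Sᴳ ; S-countable = Sᴳ-countable ; s₀ = inj₁ s₀
        ; Act = Actᴳ ; Act-finite = ⊎-finite Act-finite (subset-finite (suc m))
        ; P = Pᴳ ; Act-nonempty = Actᴳ-nonempty }
      ; owner = [ const player₁ , const player₂ ] }

    -- T ⊆ S as a set of states of 𝒢.
    target : Pred S 0ℓ → Pred Sᴳ 0ℓ
    target T = [ T , const ⊥ ]

    memberPolicy : Game.PlayerPolicy 𝒢 player₁ → ∀ i → MDP.Policy (member i)
    memberPolicy σ₁ i s with σ₁ (inj₁ s) refl
    ... | inj₁ α , av = α , same-Act zero i s α (available em av)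
    ... | inj₂ _ , ()

{-# OPTIONS --safe #-}
-- Fix i and let Player 2 answer every pair (s , α) with the class of i. The
-- chain induced in the game is then the chain of M_i with each transition out
-- of s subdivided by the state (s , σ₁ s). Inserting these states turns the
-- finite paths of M_i that first hit T into finite paths of the game chain with
-- the same weight, and all other first-hit paths of the game chain have weight
-- 0. So both reachability probabilities are the supremum of the same set, and
-- that of the game chain bounds the infimum over Player 2 from above.
module Submission where

open import Defs
open import Level using (0ℓ)
open import Algebra.Bundles using (CommutativeRing)
import Algebra.Properties.Ring as RingProperties
open import Axiom.ExcludedMiddle using (ExcludedMiddle)
open import Data.Bool using (if_then_else_)
open import Data.Empty using (⊥; ⊥-elim)
open import Data.Fin using (Fin; zero)
open import Data.Fin.Subset using (_∈_)
open import Data.List using (List; []; _∷_; map)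
open import Data.List.Properties using (∷-injective)
open import Data.List.Relation.Unary.All as All using (All; []; _∷_)
import Data.List.Relation.Unary.All.Properties as All
open import Data.List.Relation.Unary.AllPairs using ([]; _∷_)
open import Data.List.Relation.Unary.Unique.Propositional using (Unique)
import Data.List.Relation.Unary.Unique.Propositional.Properties as Unique
open import Data.Maybe as Maybe using (Maybe; just; Is-just; to-witness)
open import Data.Maybe.Relation.Unary.Any using (just)
open import Data.Maybe.Relation.Binary.Pointwise as Pointwise using (Pointwise; just)
open import Data.Product using (∃; _×_; _,_; proj₁; proj₂)
open import Data.Sum using (_⊎_; inj₁; inj₂; [_,_])
open import Data.Unit using (tt)
open import Data.Vec using (tabulate)
import Data.Vec.Properties as Vec
open import Function using (const; _∘_; _⇔_; mk⇔)
open import Function.Bundles using (Equivalence)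
open import Relation.Binary.PropositionalEquality
  using (_≡_; _≢_; refl; sym; trans; cong; subst)
import Relation.Binary.Reasoning.Setoid as SetoidReasoning
open import Relation.Binary.Structures using (IsTotalOrder)
open import Relation.Nullary using (Dec; does; yes; no)
open import Relation.Nullary.Decidable using (dec-true; dec-false; proof)
open import Relation.Nullary.Reflects using (Reflects; invert)
open import Relation.Unary using (Pred; Decidable; _⊆_)

-- Player 2 actions are Boolean vectors, so an equivalence class becomes an action only once its
-- membership is decided.
comprehension : ∀ {n} {Q : Pred (Fin n) 0ℓ} → Decidable Q → ∃ λ X → ∀ j → j ∈ X ⇔ Q j
comprehension Q? = tabulate (does ∘ Q?) , λ j → mk⇔
  -- Membership says that the entry at `j` is true; rewriting the reflection proof of `Q? j` along
  -- this leaves a proof of `Q j`.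
  (λ j∈X → invert (subst (Reflects _)
    (trans (sym (Vec.lookup∘tabulate (does ∘ Q?) j)) (Vec.[]=⇒lookup j∈X)) (proof (Q? j))))
  (λ q → Vec.lookup⇒[]= j _ (trans (Vec.lookup∘tabulate (does ∘ Q?) j) (dec-true (Q? j) q)))

module _ (em : ExcludedMiddle 0ℓ) (ℝ : CompleteOrderedField) where

  open CompleteOrderedField ℝ
  open Theory em ℝ
  private
    module R = CommutativeRing commutativeRing
    module O = IsTotalOrder isTotalOrder
  open RingProperties R.ring using (-‿involutive)
  open SetoidReasoning R.setoid hiding (stop)

  neg-antitone : ∀ {x y} → x ≤ y → - y ≤ - x
  neg-antitone {x} {y} x≤y = O.≤-respˡ-≈ cancelˡ (O.≤-respʳ-≈ cancelʳ (+-monoˡ-≤ (- x + - y) x≤y))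
    where
    cancelˡ : x + (- x + - y) ≈ - y
    cancelˡ = begin
      x + (- x + - y)  ≈⟨ R.+-assoc x (- x) (- y) ⟨
      (x + - x) + - y  ≈⟨ R.+-congʳ (R.-‿inverseʳ x) ⟩
      0# + - y         ≈⟨ R.+-identityˡ (- y) ⟩
      - y              ∎

    cancelʳ : y + (- x + - y) ≈ - x
    cancelʳ = begin
      y + (- x + - y)  ≈⟨ R.+-congˡ (R.+-comm (- x) (- y)) ⟩
      y + (- y + - x)  ≈⟨ R.+-assoc y (- y) (- x) ⟨
      (y + - y) + - x  ≈⟨ R.+-congʳ (R.-‿inverseʳ y) ⟩
      0# + - x         ≈⟨ R.+-identityˡ (- x) ⟩
      - x              ∎

  -- Boundedness, with `x` as an inhabitant, excludes the branch in which `sup` takes its default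
  -- value.
  ≤-sup : ∀ {X x} → ∃ (UpperBound X) → X x → x ≤ sup X
  ≤-sup {X} {x} bounded Xx with em {∃ X × ∃ (UpperBound X)}
  ... | yes (inhabited , bounded′) = proj₁ (proj₂ (complete X inhabited bounded′)) Xx
  ... | no ¬p                      = ⊥-elim (¬p ((x , Xx) , bounded))

  -- Inclusion in one direction alone does not suffice: the supremum of an
  -- unbounded set is 0.
  sup-cong : ∀ {X Y} → X ⊆ Y → Y ⊆ X → sup X ≤ sup Y
  sup-cong {X} {Y} X⊆Y Y⊆X with em {∃ X × ∃ (UpperBound X)} | em {∃ Y × ∃ (UpperBound Y)}
  ... | yes (i , b) | yes (j , c) = proj₂ (proj₂ (complete X i b)) λ Xx → proj₁ (proj₂ (complete Y j c)) (X⊆Y Xx)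
  ... | no _  | no _ = O.refl
  ... | yes ((x , Xx) , (u , ub)) | no ¬q = ⊥-elim (¬q ((x , X⊆Y Xx) , (u , λ Yy → ub (Y⊆X Yy))))
  ... | no ¬p | yes ((y , Yy) , (u , ub)) = ⊥-elim (¬p ((y , Y⊆X Yy) , (u , λ Xx → ub (X⊆Y Xx))))

  -- `⨅ f` is the negated supremum of the negated values. Nonnegativity of `f` bounds these above by
  -- `- 0#`, and `- f a` is one of them.
  ⨅≤ : {A : Set} {f : A → Carrier} → (∀ a → 0# ≤ f a) → ∀ a → ⨅ f ≤ f a
  ⨅≤ {f = f} 0≤f a = O.≤-respʳ-≈ (-‿involutive (f a)) (neg-antitone (≤-sup bounded (a , -‿involutive (f a))))
    where
    bounded : ∃ (UpperBound λ x → Range f (- x))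
    bounded = - 0# , λ {x} (b , -x≈fb) →
      O.≤-respˡ-≈ (-‿involutive x) (neg-antitone (O.≤-respʳ-≈ (R.sym -x≈fb) (0≤f b)))

  -- The default value of `sup` is itself 0, so both branches satisfy the bound.
  0≤sup : ∀ {X} → X 0# → 0# ≤ sup X
  0≤sup {X} X0 with em {∃ X × ∃ (UpperBound X)}
  ... | yes (i , b) = proj₁ (proj₂ (complete X i b)) X0
  ... | no _        = O.refl

  0≤ℙ : ∀ C T → 0# ≤ ℙ[ C ⊨◇ T ]
  -- The empty list of paths has partial sum 0.
  0≤ℙ C T = 0≤sup ([] , [] , [] , R.refl)

  diracMass-1 : ∀ {A : Set} {a x : A} → a ≡ x → diracMass a x ≈ 1#
  diracMass-1 a≡x = R.reflexive (cong (if_then 1# else 0#) (dec-true em a≡x))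

  diracMass-0 : ∀ {A : Set} {a x : A} → a ≢ x → diracMass a x ≈ 0#
  diracMass-0 a≢x = R.reflexive (cong (if_then 1# else 0#) (dec-false em a≢x))

  -- Reindexing along an injection e whose range contains the support of f on Q.
  module _ {A B : Set} {Q : Pred A 0ℓ} {Q′ : Pred B 0ℓ} {f : A → Carrier} {g : B → Carrier}
           (e : B → A) (f∘e≈g : ∀ b → f (e b) ≈ g b) where

    PartialSum-map : (∀ {b c} → e b ≡ e c → b ≡ c) → (∀ {b} → Q′ b → Q (e b)) →
                     PartialSum Q′ g ⊆ PartialSum Q f
    PartialSum-map e-inj e-Q (ys , ys! , Q′ys , x≈) =
      map e ys , Unique.map⁺ e-inj ys! , All.map⁺ (All.map e-Q Q′ys) , R.trans x≈ (R.sym (sum-map ys))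
      where
      sum-map : ∀ ys → sum f (map e ys) ≈ sum g ys
      sum-map []       = R.refl
      sum-map (y ∷ ys) = R.+-cong (f∘e≈g y) (sum-map ys)

    PartialSum-support : (∀ {a} → Q a → (∃ λ b → Q′ b × a ≡ e b) ⊎ f a ≈ 0#) →
                         PartialSum Q f ⊆ PartialSum Q′ g
    PartialSum-support support (xs , xs! , Qxs , x≈) with preimages xs! Qxs
      where
      preimages : ∀ {xs} → Unique xs → All Q xs → ∃ λ ys →
                  Unique ys × All Q′ ys × sum f xs ≈ sum g ys ×
                  -- This clause carries uniqueness through the recursion: a new preimage is
                  -- distinct from those already collected because its image is fresh in `xs`.
                  (∀ {b} → All (e b ≢_) xs → All (b ≢_) ys)
      preimages [] [] = [] , [] , [] , R.refl , λ _ → []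
      preimages (x∉xs ∷ xs!) (Qx ∷ Qxs) with support Qx | preimages xs! Qxs
      ... | inj₂ fx≈0 | ys , ys! , Q′ys , sum≈ , fresh =
        ys , ys! , Q′ys , R.trans (R.+-cong fx≈0 sum≈) (R.+-identityˡ _) , fresh ∘ All.tail
      ... | inj₁ (b , Q′b , refl) | ys , ys! , Q′ys , sum≈ , fresh =
        b ∷ ys , fresh x∉xs ∷ ys! , Q′b ∷ Q′ys , R.+-cong (f∘e≈g b) sum≈ ,
        λ { (p ∷ ps) → (p ∘ cong e) ∷ fresh ps }
    ... | ys , ys! , Q′ys , sum≈ , _ = ys , ys! , Q′ys , R.trans x≈ sum≈

  -- C is D with every transition out of s subdivided by the state inj₂ (mid s).
  module Subdivision (D : MarkovChain) (U : Set) (mid : MarkovChain.S D → U)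
    (Pᶜ : MarkovChain.S D ⊎ U → Distr (MarkovChain.S D ⊎ U))
    (P₁ : ∀ s → Pᶜ (inj₁ s) ≈ᴰ dirac (inj₂ (mid s)))
    (P₂ : ∀ s → Pᶜ (inj₂ (mid s)) ≈ᴰ embed U (MarkovChain.P D s))
    (T : Pred (MarkovChain.S D) 0ℓ) where

    open MarkovChain D

    C : MarkovChain
    C = record { S = S ⊎ U ; s₀ = inj₁ s₀ ; P = Pᶜ }

    Tᶜ : Pred (S ⊎ U) 0ℓ
    Tᶜ = [ T , const ⊥ ]

    subdivide : S → List S → List (S ⊎ U)
    subdivide s []      = []
    subdivide s (t ∷ π) = inj₂ (mid s) ∷ inj₁ t ∷ subdivide t π

    -- The original states remain at every second position and determine the path.
    subdivide-injective : ∀ s {π ρ} → subdivide s π ≡ subdivide s ρ → π ≡ ρ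
    subdivide-injective s {[]}    {[]}    _ = refl
    subdivide-injective s {t ∷ π} {u ∷ ρ} e
      with refl , e′ ← ∷-injective (proj₂ (∷-injective e)) = cong (t ∷_) (subdivide-injective t e′)

    -- Entering an inserted state has probability 1, and leaving it has the probability of the
    -- original transition.
    cylinder-subdivide : ∀ s π → cylinder C Tᶜ (inj₁ s) (subdivide s π) ≈ cylinder D T s π
    cylinder-subdivide s []      = R.refl
    cylinder-subdivide s (t ∷ π) = begin
      mass (Pᶜ (inj₁ s)) (inj₂ (mid s)) * (mass (Pᶜ (inj₂ (mid s))) (inj₁ t) * rest)
        ≈⟨ R.*-cong (R.trans (P₁ s _) (diracMass-1 refl)) (R.*-cong (P₂ s _) (cylinder-subdivide t π)) ⟩
      1# * (mass (P s) t * cylinder D T t π)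
        ≈⟨ R.*-identityˡ _ ⟩
      mass (P s) t * cylinder D T t π ∎
      where rest = cylinder C Tᶜ (inj₁ t) (subdivide t π)

    FirstHit-subdivide : ∀ {s π} → FirstHit D T s π → FirstHit C Tᶜ (inj₁ s) (subdivide s π)
    FirstHit-subdivide (stop Ts)    = stop Ts
    FirstHit-subdivide (step ¬Ts h) = step ¬Ts (step (λ ()) (FirstHit-subdivide h))

    -- A path that fails to alternate between original states and the correct inserted ones contains
    -- a step of mass 0, which annihilates the product.
    cylinder-support : ∀ {s π} → FirstHit C Tᶜ (inj₁ s) π →
      (∃ λ ρ → FirstHit D T s ρ × π ≡ subdivide s ρ) ⊎ cylinder C Tᶜ (inj₁ s) π ≈ 0#
    cylinder-support (stop Ts) = inj₁ ([] , stop Ts , refl)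
    cylinder-support {s} (step {t = inj₁ _} _ _) =
      inj₂ (R.trans (R.*-congʳ (R.trans (P₁ s _) (diracMass-0 λ ()))) (R.zeroˡ _))
    cylinder-support {s} (step {t = inj₂ u} ¬Ts h) with em {inj₂ (mid s) ≡ inj₂ u}
    ... | no ≢ = inj₂ (R.trans (R.*-congʳ (R.trans (P₁ s _) (diracMass-0 ≢))) (R.zeroˡ _))
    -- The path cannot stop at the inserted state, where `Tᶜ` is empty; `embed` gives mass 0 to a
    -- second inserted state in a row.
    cylinder-support {s} (step _ (step {t = inj₂ _} _ _)) | yes refl =
      inj₂ (R.trans (R.*-congˡ (R.trans (R.*-congʳ (P₂ s _)) (R.zeroˡ _))) (R.zeroʳ _))
    cylinder-support {s} (step ¬Ts (step {t = inj₁ t} _ h)) | yes refl with cylinder-support h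
    ... | inj₁ (ρ , h′ , refl) = inj₁ (t ∷ ρ , step ¬Ts h′ , refl)
    ... | inj₂ ≈0 = inj₂ (R.trans (R.*-congˡ (R.trans (R.*-congˡ ≈0) (R.zeroʳ _))) (R.zeroʳ _))

    ℙ-subdivide : ℙ[ C ⊨◇ Tᶜ ] ≤ ℙ[ D ⊨◇ T ]
    ℙ-subdivide = sup-cong
      (PartialSum-support (subdivide s₀) (cylinder-subdivide s₀) cylinder-support)
      (PartialSum-map (subdivide s₀) (cylinder-subdivide s₀) (subdivide-injective s₀) FirstHit-subdivide)

  embed-cong : ∀ {A B : Set} {x y : Maybe (Distr A)} → Pointwise _≈ᴰ_ x y → (p : Is-just y) →
               ∃ λ (q : Is-just (Maybe.map (embed B) x)) → to-witness q ≈ᴰ embed B (to-witness p)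
  embed-cong (just x≈y) (just _) = just tt , λ { (inj₁ a) → x≈y a ; (inj₂ _) → R.refl }

  module _ (ℳ : Family) (σ₁ : Game.PlayerPolicy (GameAbstraction.𝒢 ℳ) player₁) (i : Family.I ℳ) where
    open Family ℳ
    open GameAbstraction ℳ

    -- `resolve` may choose a representative `j` other than `i`, but `i` lies in its own class,
    -- which is also that of `j`, so their distributions agree. The decision `d` is a variable so
    -- that it can be split on.
    resolve-class : ∀ s α {X} → IsClassOf s α X i → (p : Is-just (P i s α)) →
      (d : Dec (∃ (IsClassOf s α X))) →
      ∃ λ (q : Is-just (resolve s α {X} d)) → to-witness q ≈ᴰ embed S₂ (to-witness p)
    resolve-class s α X[i] p (no ¬cl)       = ⊥-elim (¬cl (i , X[i]))
    resolve-class s α X[i] p (yes (j , X[j])) = embed-cong j∼i p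
      where
      j∼i : j ∼[ s , α ] i
      j∼i = Equivalence.to (X[j] i) (Equivalence.from (X[i] i) (Pointwise.refl λ _ → R.refl))

    classOf : ∀ s α → ∃ λ X → IsClassOf s α X i
    classOf s α = comprehension λ j → em {i ∼[ s , α ] j}

    answer : ((s , α , av) : S₂) →
      ∃ λ (q : Is-just (resolve s α {proj₁ (classOf s α)} em)) →
        to-witness q ≈ᴰ embed S₂ (to-witness (same-Act zero i s α av))
    answer (s , α , av) = resolve-class s α (proj₂ (classOf s α)) (same-Act zero i s α av) em

    classPolicy : Game.PlayerPolicy 𝒢 player₂
    classPolicy (inj₂ y@(s , α , _)) _ = inj₂ (proj₁ (classOf s α)) , proj₁ (answer y)

    D : MarkovChain
    D = MDP.induced (member i) (memberPolicy σ₁ i)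

    move-dirac : ∀ s α (d : Dec (Available s α)) (q : Is-just (move s α d)) →
                 to-witness q ≡ dirac (inj₂ (s , α , available d q))
    move-dirac s α (yes av) (just _) = refl

    -- `memberPolicy` computes only after a split on `σ₁ (inj₁ s) refl`. One such split yields the
    -- action together with the transitions of both chains.
    chosen : ∀ s → ∃ λ α → ∃ λ (av : Available s α) →
      to-witness (proj₂ (σ₁ (inj₁ s) refl)) ≡ dirac (inj₂ (s , α , av)) ×
      MarkovChain.P D s ≡ to-witness (same-Act zero i s α av)
    chosen s with σ₁ (inj₁ s) refl
    ... | inj₁ α , q = α , available em q , move-dirac s α em q , refl
    ... | inj₂ _ , ()

    mid : S → S₂
    mid s with α , av , _ ← chosen s = s , α , av

    ℙ-classPolicy : (T : Pred S 0ℓ) →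
      ℙ[ MDP.induced (Game.mdp 𝒢) (Game.combine 𝒢 σ₁ classPolicy) ⊨◇ target T ] ≤ ℙ[ D ⊨◇ T ]
    ℙ-classPolicy = Subdivision.ℙ-subdivide D S₂ mid
      (MarkovChain.P (MDP.induced (Game.mdp 𝒢) (Game.combine 𝒢 σ₁ classPolicy)))
      -- `owner` computes on `inj₁` and `inj₂`, so `combine` reduces to `σ₁` here and to
      -- `classPolicy` in the next argument.
      (λ s x → R.reflexive (cong (λ d → mass d x) (proj₁ (proj₂ (proj₂ (chosen s))))))
      (λ s x → R.trans (proj₂ (answer (mid s)) x)
        (R.reflexive (cong (λ d → mass (embed S₂ d) x) (sym (proj₂ (proj₂ (proj₂ (chosen s))))))))

theorem1 : (em : ExcludedMiddle 0ℓ) (ℝ : CompleteOrderedField) →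
    let open CompleteOrderedField ℝ
        open Theory em ℝ
    in (ℳ : Family) →
    let open Family ℳ
        open GameAbstraction ℳ
    in (T : Pred S 0ℓ) (lam : Carrier) → 0# ≤ lam → lam ≤ 1# →
       (σ₁ : Game.PlayerPolicy 𝒢 player₁) → Game.AchievedBy 𝒢 (target T) σ₁ →
       lam ≤ Game.ℙmax 𝒢 (target T) →
       ∀ i → lam ≤ ℙ[ MDP.induced (member i) (memberPolicy σ₁ i) ⊨◇ T ]
theorem1 em ℝ ℳ T lam _ _ σ₁ achieved lam≤ℙmax i =
  -- Optimality replaces the game value by the infimum secured by `σ₁`, which is then bounded by the
  -- single reply `classPolicy`.
  O.trans lam≤ℙmax (O.trans (O.reflexive (R.sym achieved)) (O.trans
    (⨅≤ em ℝ (λ σ₂ → 0≤ℙ em ℝ _ _) (classPolicy em ℝ ℳ σ₁ i))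
    (ℙ-classPolicy em ℝ ℳ σ₁ i T)))
  where
  module R = CommutativeRing (CompleteOrderedField.commutativeRing ℝ)
  module O = IsTotalOrder (CompleteOrderedField.isTotalOrder ℝ)
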